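{- Let $r\in\mathbb{C}$ and let $m,n$ be positive integers. Then $$\sum_{k=0}^n(-1)^k\binom{r-1}{k}\sum_{j=m}^{k+1}\binom{k}{j-1}\frac{s(j,m)}{j!}=(-1)^n\binom{r-1}{n}\frac{1}{m!}H_{n+1}(m)-\frac{1}{m!}\sum_{k=0}^n(-1)^k\binom{r}{k}H_k(m).$$ In particular, $\sum_{k=0}^n\frac{(-1)^k}{k+1}\binom{r-1}{k}=(-1)^n\binom{r-1}{n}H_{n+1}-\sum_{k=0}^n(-1)^k\binom{r}{k}H_k$.
   Context: For integers $m\ge 1$, $n\ge 0$, the multiple harmonic-like numbers are $H_n(m)=\sum_{1\le k_1+k_2+\cdots+k_m\le n}\frac{1}{k_1k_2\cdots k_m}$ (sum over positive integers $k_1,\dots,k_m$), with $H_n(0)=1$ for $n\ge 0$ and $H_0(m)=0$ for $m\ge1$. $H_n=H_n(1)=\sum_{k=1}^n\frac1k$. The (signed) Stirling numbers of the first kind $s(n,k)$ are defined by $\sum_{n\ge k}s(n,k)\frac{z^n}{n!}=\frac{\ln^k(1+z)}{k!}$, with $s(n,k)=0$ for $n<k$. For complex $x$, $\binom{x}{k}=\frac{x(x-1)\cdots(x-k+1)}{k!}$. -}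

module Defs where

open import Algebra.Bundles using (CommutativeRing; Semiring)
open import Data.Fin.Base using (Fin; toℕ)
open import Data.Integer.Base using (+_)
open import Data.List.Base using (List; []; _∷_; map; foldr; filter; allFin; cartesianProductWith)
open import Data.Nat.Base as ℕ using (ℕ; zero; suc; _!; _∸_)
import Data.Nat.Properties as ℕ
open import Data.Product.Base using (∃; _,_; _×_)
open import Data.Rational.Base as ℚ using (ℚ; 0ℚ; 1ℚ; ½)
import Data.Rational.Properties as ℚ
open import Data.Rational.Solver using (module +-*-Solver)
open import Data.Vec.Base as Vec using (Vec)
open import Level using (0ℓ)
open import Relation.Binary.PropositionalEquality using (_≡_; refl; sym; trans; cong; subst; subst₂)
open import Relation.Nullary.Decidable using (_×-dec_)
import Algebra.Definitions.RawSemiring as RawSemiringDefinitions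
import Algebra.Properties.Monoid.Sum as MonoidSum

open +-*-Solver using (solve; _:=_; _:+_; _:*_; :-_; _:-_; con)

-- The real numbers: Cauchy sequences of rationals, with equality
-- "the difference tends to 0" as setoid equality.  No eta for ℝ and ℂ:
-- their operations then unfold only under projections, which keeps them
-- inferable in the ring laws.

Within : ℚ → ℚ → ℚ → Set
Within ε a b = ℚ.∣ a ℚ.- b ∣ ℚ.< ε

record ℝ : Set where
  no-eta-equality
  field
    seq    : ℕ → ℚ
    cauchy : ∀ ε → 0ℚ ℚ.< ε →
             ∃ λ N → ∀ m n → N ℕ.≤ m → N ℕ.≤ n → Within ε (seq m) (seq n)

open ℝ public

infix 4 _≈ᴿ_
_≈ᴿ_ : ℝ → ℝ → Set
x ≈ᴿ y = ∀ ε → 0ℚ ℚ.< ε →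
         ∃ λ N → ∀ n → N ℕ.≤ n → Within ε (seq x n) (seq y n)

private
  half-pos : ∀ {ε} → 0ℚ ℚ.< ε → 0ℚ ℚ.< ½ ℚ.* ε
  half-pos {ε} 0<ε = ℚ.positive⁻¹ (½ ℚ.* ε) {{ℚ.pos*pos⇒pos ½ ε {{ℚ.positive 0<ε}}}}

  halves : ∀ ε → ½ ℚ.* ε ℚ.+ ½ ℚ.* ε ≡ ε
  halves = solve 1 (λ e → con ½ :* e :+ con ½ :* e := e) refl

  within-refl : ∀ {ε a b} → 0ℚ ℚ.< ε → a ≡ b → Within ε a b
  within-refl {ε} {a} 0<ε refl =
    subst (ℚ._< ε) (sym (cong ℚ.∣_∣ (ℚ.+-inverseʳ a))) 0<ε

  within-sym : ∀ {ε a b} → Within ε a b → Within ε b a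
  within-sym {ε} {a} {b} p = subst (ℚ._< ε)
    (trans (sym (ℚ.∣-p∣≡∣p∣ (a ℚ.- b)))
           (cong ℚ.∣_∣ (solve 2 (λ a b → :- (a :- b) := b :- a) refl a b))) p

  triangle : ∀ {ε} x y → ℚ.∣ x ∣ ℚ.< ½ ℚ.* ε → ℚ.∣ y ∣ ℚ.< ½ ℚ.* ε → ℚ.∣ x ℚ.+ y ∣ ℚ.< ε
  triangle {ε} x y p q = ℚ.≤-<-trans (ℚ.∣p+q∣≤∣p∣+∣q∣ x y)
    (subst (ℚ.∣ x ∣ ℚ.+ ℚ.∣ y ∣ ℚ.<_) (halves ε) (ℚ.+-mono-< p q))

  within-trans : ∀ {ε a b c} → Within (½ ℚ.* ε) a b → Within (½ ℚ.* ε) b c → Within ε a c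
  within-trans {ε} {a} {b} {c} p q = subst (λ t → ℚ.∣ t ∣ ℚ.< ε)
    (solve 3 (λ a b c → (a :- b) :+ (b :- c) := a :- c) refl a b c)
    (triangle (a ℚ.- b) (b ℚ.- c) p q)

  within-+ : ∀ {ε a b c d} → Within (½ ℚ.* ε) a c → Within (½ ℚ.* ε) b d →
             Within ε (a ℚ.+ b) (c ℚ.+ d)
  within-+ {ε} {a} {b} {c} {d} p q = subst (λ t → ℚ.∣ t ∣ ℚ.< ε)
    (solve 4 (λ a b c d → (a :- c) :+ (b :- d) := (a :+ b) :- (c :+ d)) refl a b c d)
    (triangle (a ℚ.- c) (b ℚ.- d) p q)

  within-neg : ∀ {ε a b} → Within ε a b → Within ε (ℚ.- a) (ℚ.- b)
  within-neg {ε} {a} {b} p = subst (ℚ._< ε)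
    (cong ℚ.∣_∣ (solve 2 (λ a b → b :- a := :- a :- :- b) refl a b))
    (within-sym {ε} {a} {b} p)

  -- Given B > 0 bounding the factors, δ B ε is an accuracy of the factors
  -- sufficient for accuracy ε of the product.
  δ : ∀ B → 0ℚ ℚ.< B → ℚ → ℚ
  δ B 0<B ε = (ℚ.1/ B) {{ℚ.pos⇒nonZero B {{ℚ.positive 0<B}}}} ℚ.* (½ ℚ.* ε)

  δ-pos : ∀ B (0<B : 0ℚ ℚ.< B) {ε} → 0ℚ ℚ.< ε → 0ℚ ℚ.< δ B 0<B ε
  δ-pos B 0<B {ε} 0<ε = ℚ.positive⁻¹ (δ B 0<B ε)
    {{ℚ.pos*pos⇒pos ((ℚ.1/ B) {{nz}}) {{ℚ.1/pos⇒pos B {{ℚ.positive 0<B}}}}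
                    (½ ℚ.* ε) {{ℚ.positive (half-pos 0<ε)}}}}
    where nz = ℚ.pos⇒nonZero B {{ℚ.positive 0<B}}

  δ-cancel : ∀ B (0<B : 0ℚ ℚ.< B) ε → B ℚ.* δ B 0<B ε ≡ ½ ℚ.* ε
  δ-cancel B 0<B ε =
    trans (sym (ℚ.*-assoc B ((ℚ.1/ B) {{nz}}) (½ ℚ.* ε)))
    (trans (cong (ℚ._* (½ ℚ.* ε)) (ℚ.*-inverseʳ B {{nz}}))
           (ℚ.*-identityˡ (½ ℚ.* ε)))
    where nz = ℚ.pos⇒nonZero B {{ℚ.positive 0<B}}

  product-bound : ∀ B (0<B : 0ℚ ℚ.< B) {ε} x y → ℚ.∣ x ∣ ℚ.< B → ℚ.∣ y ∣ ℚ.< δ B 0<B ε →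
                  ℚ.∣ x ℚ.* y ∣ ℚ.< ½ ℚ.* ε
  product-bound B 0<B {ε} x y p q = subst₂ ℚ._<_
    (sym (ℚ.∣p*q∣≡∣p∣*∣q∣ x y)) (δ-cancel B 0<B ε)
    (ℚ.≤-<-trans
      (ℚ.*-monoʳ-≤-nonNeg ℚ.∣ y ∣ {{ℚ.nonNegative (ℚ.0≤∣p∣ y)}} (ℚ.<⇒≤ p))
      (ℚ.*-monoʳ-<-pos B {{ℚ.positive 0<B}} q))

  within-* : ∀ B (0<B : 0ℚ ℚ.< B) {ε a b c d} → ℚ.∣ a ∣ ℚ.< B → ℚ.∣ d ∣ ℚ.< B →
             Within (δ B 0<B ε) a c → Within (δ B 0<B ε) b d →
             Within ε (a ℚ.* b) (c ℚ.* d)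
  within-* B 0<B {ε} {a} {b} {c} {d} ∣a∣<B ∣d∣<B p q = subst (λ t → ℚ.∣ t ∣ ℚ.< ε)
    (solve 4 (λ a b c d → a :* (b :- d) :+ d :* (a :- c) := a :* b :- c :* d) refl a b c d)
    (triangle (a ℚ.* (b ℚ.- d)) (d ℚ.* (a ℚ.- c))
      (product-bound B 0<B {ε} a (b ℚ.- d) ∣a∣<B q)
      (product-bound B 0<B {ε} d (a ℚ.- c) ∣d∣<B p))

  EventuallyBelow : ℝ → ℚ → Set
  EventuallyBelow x B = ∃ λ N → ∀ n → N ℕ.≤ n → ℚ.∣ seq x n ∣ ℚ.< B

  0<1 : 0ℚ ℚ.< 1ℚ
  0<1 = ℚ.positive⁻¹ 1ℚ

  bound : ∀ x → ∃ λ B → 0ℚ ℚ.< B × EventuallyBelow x B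
  bound x with cauchy x 1ℚ 0<1
  ... | N , close = B , 0<B , N , λ n N≤n → subst (λ t → ℚ.∣ t ∣ ℚ.< B)
          (solve 2 (λ a b → (a :- b) :+ b := a) refl (seq x n) (seq x N))
          (ℚ.≤-<-trans (ℚ.∣p+q∣≤∣p∣+∣q∣ (seq x n ℚ.- seq x N) (seq x N))
            (ℚ.+-monoˡ-< ℚ.∣ seq x N ∣ (close n N N≤n ℕ.≤-refl)))
    where
    B = 1ℚ ℚ.+ ℚ.∣ seq x N ∣
    0<B : 0ℚ ℚ.< B
    0<B = ℚ.+-mono-<-≤ 0<1 (ℚ.0≤∣p∣ (seq x N))

  common-bound : ∀ x y → ∃ λ B → 0ℚ ℚ.< B × EventuallyBelow x B × EventuallyBelow y B
  common-bound x y =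
    let A , 0<A , M , x<A = bound x
        B , 0<B , N , y<B = bound y
    in A ℚ.+ B , +-pos A B 0<A 0<B ,
       (M , λ n M≤n → ℚ.<-trans (x<A n M≤n) (<-+ʳ A B 0<B)) ,
       (N , λ n N≤n → ℚ.<-trans (y<B n N≤n) (<-+ˡ A B 0<A))
    where
    +-pos : ∀ A B → 0ℚ ℚ.< A → 0ℚ ℚ.< B → 0ℚ ℚ.< A ℚ.+ B
    +-pos A B p q = ℚ.+-mono-< p q
    <-+ʳ : ∀ A B → 0ℚ ℚ.< B → A ℚ.< A ℚ.+ B
    <-+ʳ A B p = subst (ℚ._< A ℚ.+ B) (ℚ.+-identityʳ A) (ℚ.+-monoʳ-< A p)
    <-+ˡ : ∀ A B → 0ℚ ℚ.< A → B ℚ.< A ℚ.+ B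
    <-+ˡ A B p = subst (ℚ._< A ℚ.+ B) (ℚ.+-identityˡ B) (ℚ.+-monoˡ-< B p)

  ⊔-l : ∀ {M N n} → M ℕ.⊔ N ℕ.≤ n → M ℕ.≤ n
  ⊔-l {M} {N} = ℕ.m⊔n≤o⇒m≤o M N

  ⊔-r : ∀ {M N n} → M ℕ.⊔ N ℕ.≤ n → N ℕ.≤ n
  ⊔-r {M} {N} = ℕ.m⊔n≤o⇒n≤o M N

fromℚᴿ : ℚ → ℝ
seq    (fromℚᴿ q) _ = q
cauchy (fromℚᴿ q) ε 0<ε = 0 , λ _ _ _ _ → within-refl {ε} {q} 0<ε refl

infixl 6 _+ᴿ_
infixl 7 _*ᴿ_
infix  8 -ᴿ_

_+ᴿ_ : ℝ → ℝ → ℝ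
seq    (x +ᴿ y) n = seq x n ℚ.+ seq y n
cauchy (x +ᴿ y) ε 0<ε =
  let M , p = cauchy x (½ ℚ.* ε) (half-pos 0<ε)
      N , q = cauchy y (½ ℚ.* ε) (half-pos 0<ε)
  in M ℕ.⊔ N , λ m n a b →
     within-+ {ε} {seq x m} {seq y m} (p m n (⊔-l {M} a) (⊔-l {M} b)) (q m n (⊔-r {M} a) (⊔-r {M} b))

-ᴿ_ : ℝ → ℝ
seq    (-ᴿ x) n = ℚ.- seq x n
cauchy (-ᴿ x) ε 0<ε =
  let N , p = cauchy x ε 0<ε
  in N , λ m n a b → within-neg {ε} {seq x m} (p m n a b)

_*ᴿ_ : ℝ → ℝ → ℝ
seq    (x *ᴿ y) n = seq x n ℚ.* seq y n
cauchy (x *ᴿ y) ε 0<ε =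
  let B , 0<B , (K , x<B) , (L , y<B) = common-bound x y
      M , p = cauchy x (δ B 0<B ε) (δ-pos B 0<B 0<ε)
      N , q = cauchy y (δ B 0<B ε) (δ-pos B 0<B 0<ε)
  in (K ℕ.⊔ L) ℕ.⊔ (M ℕ.⊔ N) , λ m n a b →
     within-* B 0<B {ε} {seq x m} {seq y m}
       (x<B m (⊔-l {K} (⊔-l {K ℕ.⊔ L} a))) (y<B n (⊔-r {K} (⊔-l {K ℕ.⊔ L} b)))
       (p m n (⊔-l {M} (⊔-r {K ℕ.⊔ L} a)) (⊔-l {M} (⊔-r {K ℕ.⊔ L} b)))
       (q m n (⊔-r {M} (⊔-r {K ℕ.⊔ L} a)) (⊔-r {M} (⊔-r {K ℕ.⊔ L} b)))

pointwise : ∀ {x y} → (∀ n → seq x n ≡ seq y n) → x ≈ᴿ y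
pointwise eq ε 0<ε = 0 , λ n _ → within-refl 0<ε (eq n)

≈ᴿ-refl : ∀ {x} → x ≈ᴿ x
≈ᴿ-refl {x} = pointwise {x} {x} λ _ → refl

≈ᴿ-sym : ∀ {x y} → x ≈ᴿ y → y ≈ᴿ x
≈ᴿ-sym {x} {y} x≈y ε 0<ε =
  let N , p = x≈y ε 0<ε in N , λ n a → within-sym {ε} {seq x n} (p n a)

≈ᴿ-trans : ∀ {x y z} → x ≈ᴿ y → y ≈ᴿ z → x ≈ᴿ z
≈ᴿ-trans {x} {y} {z} x≈y y≈z ε 0<ε =
  let M , p = x≈y (½ ℚ.* ε) (half-pos 0<ε)
      N , q = y≈z (½ ℚ.* ε) (half-pos 0<ε)
  in M ℕ.⊔ N , λ n a → within-trans {ε} {seq x n} {seq y n} (p n (⊔-l {M} a)) (q n (⊔-r {M} a))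

+ᴿ-cong : ∀ {x x′ y y′} → x ≈ᴿ x′ → y ≈ᴿ y′ → x +ᴿ y ≈ᴿ x′ +ᴿ y′
+ᴿ-cong {x} {x′} {y} {y′} x≈ y≈ ε 0<ε =
  let M , p = x≈ (½ ℚ.* ε) (half-pos 0<ε)
      N , q = y≈ (½ ℚ.* ε) (half-pos 0<ε)
  in M ℕ.⊔ N , λ n a → within-+ {ε} {seq x n} {seq y n} (p n (⊔-l {M} a)) (q n (⊔-r {M} a))

-ᴿ-cong : ∀ {x y} → x ≈ᴿ y → -ᴿ x ≈ᴿ -ᴿ y
-ᴿ-cong {x} x≈y ε 0<ε =
  let N , p = x≈y ε 0<ε in N , λ n a → within-neg {ε} {seq x n} (p n a)

*ᴿ-cong : ∀ {x x′ y y′} → x ≈ᴿ x′ → y ≈ᴿ y′ → x *ᴿ y ≈ᴿ x′ *ᴿ y′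
*ᴿ-cong {x} {x′} {y} {y′} x≈ y≈ ε 0<ε =
  let B , 0<B , (K , x<B) , (L , y′<B) = common-bound x y′
      M , p = x≈ (δ B 0<B ε) (δ-pos B 0<B 0<ε)
      N , q = y≈ (δ B 0<B ε) (δ-pos B 0<B 0<ε)
  in (K ℕ.⊔ L) ℕ.⊔ (M ℕ.⊔ N) , λ n a →
     within-* B 0<B {ε} {seq x n} {seq y n}
       (x<B n (⊔-l {K} (⊔-l {K ℕ.⊔ L} a))) (y′<B n (⊔-r {K} (⊔-l {K ℕ.⊔ L} a)))
       (p n (⊔-l {M} (⊔-r {K ℕ.⊔ L} a)))
       (q n (⊔-r {M} (⊔-r {K ℕ.⊔ L} a)))

record ℂ : Set where
  no-eta-equality
  field
    re im : ℝ

open ℂ public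

record _≈ᶜ_ (z w : ℂ) : Set where
  constructor mk≈ᶜ
  field
    re-≈ : re z ≈ᴿ re w
    im-≈ : im z ≈ᴿ im w

open _≈ᶜ_ public

infix  4 _≈ᶜ_
infixl 6 _+ᶜ_
infixl 7 _*ᶜ_
infix  8 -ᶜ_

_+ᶜ_ : ℂ → ℂ → ℂ
re (z +ᶜ w) = re z +ᴿ re w
im (z +ᶜ w) = im z +ᴿ im w

_*ᶜ_ : ℂ → ℂ → ℂ
re (z *ᶜ w) = re z *ᴿ re w +ᴿ -ᴿ (im z *ᴿ im w)
im (z *ᶜ w) = re z *ᴿ im w +ᴿ im z *ᴿ re w

-ᶜ_ : ℂ → ℂ
re (-ᶜ z) = -ᴿ re z
im (-ᶜ z) = -ᴿ im z

ι : ℚ → ℂ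
re (ι q) = fromℚᴿ q
im (ι q) = fromℚᴿ 0ℚ

pointwiseᶜ : ∀ {z w} → (∀ n → seq (re z) n ≡ seq (re w) n) →
             (∀ n → seq (im z) n ≡ seq (im w) n) → z ≈ᶜ w
pointwiseᶜ {z} {w} p q = mk≈ᶜ (pointwise {re z} {re w} p) (pointwise {im z} {im w} q)

private
  ≈ᶜ-refl : ∀ {z} → z ≈ᶜ z
  ≈ᶜ-refl {z} = mk≈ᶜ (≈ᴿ-refl {re z}) (≈ᴿ-refl {im z})

  ≈ᶜ-sym : ∀ {z w} → z ≈ᶜ w → w ≈ᶜ z
  ≈ᶜ-sym {z} {w} (mk≈ᶜ p q) = mk≈ᶜ (≈ᴿ-sym {re z} {re w} p) (≈ᴿ-sym {im z} {im w} q)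

  ≈ᶜ-trans : ∀ {z w v} → z ≈ᶜ w → w ≈ᶜ v → z ≈ᶜ v
  ≈ᶜ-trans {z} {w} {v} (mk≈ᶜ p q) (mk≈ᶜ p′ q′) =
    mk≈ᶜ (≈ᴿ-trans {re z} {re w} {re v} p p′) (≈ᴿ-trans {im z} {im w} {im v} q q′)

  +ᶜ-cong : ∀ {z z′ w w′} → z ≈ᶜ z′ → w ≈ᶜ w′ → z +ᶜ w ≈ᶜ z′ +ᶜ w′
  +ᶜ-cong {z} {z′} {w} {w′} (mk≈ᶜ p q) (mk≈ᶜ p′ q′) =
    mk≈ᶜ (+ᴿ-cong {re z} {re z′} {re w} {re w′} p p′) (+ᴿ-cong {im z} {im z′} {im w} {im w′} q q′)

  -ᶜ-cong : ∀ {z w} → z ≈ᶜ w → -ᶜ z ≈ᶜ -ᶜ w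
  -ᶜ-cong {z} {w} (mk≈ᶜ p q) = mk≈ᶜ (-ᴿ-cong {re z} {re w} p) (-ᴿ-cong {im z} {im w} q)

  *ᶜ-cong : ∀ {z z′ w w′} → z ≈ᶜ z′ → w ≈ᶜ w′ → z *ᶜ w ≈ᶜ z′ *ᶜ w′
  *ᶜ-cong {z} {z′} {w} {w′} (mk≈ᶜ p q) (mk≈ᶜ p′ q′) = mk≈ᶜ
    (+ᴿ-cong {re z *ᴿ re w} {re z′ *ᴿ re w′} { -ᴿ (im z *ᴿ im w)} { -ᴿ (im z′ *ᴿ im w′)}
      (*ᴿ-cong {re z} {re z′} {re w} {re w′} p p′)
      (-ᴿ-cong {im z *ᴿ im w} {im z′ *ᴿ im w′} (*ᴿ-cong {im z} {im z′} {im w} {im w′} q q′)))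
    (+ᴿ-cong {re z *ᴿ im w} {re z′ *ᴿ im w′} {im z *ᴿ re w} {im z′ *ᴿ re w′}
      (*ᴿ-cong {re z} {re z′} {im w} {im w′} p q′)
      (*ᴿ-cong {im z} {im z′} {re w} {re w′} q p′))

  +ᶜ-assoc : ∀ z w v → (z +ᶜ w) +ᶜ v ≈ᶜ z +ᶜ (w +ᶜ v)
  +ᶜ-assoc z w v = pointwiseᶜ
    (λ n → ℚ.+-assoc (seq (re z) n) (seq (re w) n) (seq (re v) n))
    (λ n → ℚ.+-assoc (seq (im z) n) (seq (im w) n) (seq (im v) n))

  +ᶜ-comm : ∀ z w → z +ᶜ w ≈ᶜ w +ᶜ z
  +ᶜ-comm z w = pointwiseᶜ
    (λ n → ℚ.+-comm (seq (re z) n) (seq (re w) n))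
    (λ n → ℚ.+-comm (seq (im z) n) (seq (im w) n))

  +ᶜ-identityˡ : ∀ z → ι 0ℚ +ᶜ z ≈ᶜ z
  +ᶜ-identityˡ z = pointwiseᶜ
    (λ n → ℚ.+-identityˡ (seq (re z) n)) (λ n → ℚ.+-identityˡ (seq (im z) n))

  -ᶜ-inverseˡ : ∀ z → -ᶜ z +ᶜ z ≈ᶜ ι 0ℚ
  -ᶜ-inverseˡ z = pointwiseᶜ
    (λ n → ℚ.+-inverseˡ (seq (re z) n)) (λ n → ℚ.+-inverseˡ (seq (im z) n))

  *ᶜ-assoc : ∀ z w v → (z *ᶜ w) *ᶜ v ≈ᶜ z *ᶜ (w *ᶜ v)
  *ᶜ-assoc z w v = pointwiseᶜ
    (λ n → solve 6 (λ a b c d e f →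
        (a :* c :+ :- (b :* d)) :* e :+ :- ((a :* d :+ b :* c) :* f) :=
        a :* (c :* e :+ :- (d :* f)) :+ :- (b :* (c :* f :+ d :* e))) refl
      (seq (re z) n) (seq (im z) n) (seq (re w) n) (seq (im w) n) (seq (re v) n) (seq (im v) n))
    (λ n → solve 6 (λ a b c d e f →
        (a :* c :+ :- (b :* d)) :* f :+ (a :* d :+ b :* c) :* e :=
        a :* (c :* f :+ d :* e) :+ b :* (c :* e :+ :- (d :* f))) refl
      (seq (re z) n) (seq (im z) n) (seq (re w) n) (seq (im w) n) (seq (re v) n) (seq (im v) n))

  *ᶜ-comm : ∀ z w → z *ᶜ w ≈ᶜ w *ᶜ z
  *ᶜ-comm z w = pointwiseᶜ
    (λ n → solve 4 (λ a b c d → a :* c :+ :- (b :* d) := c :* a :+ :- (d :* b)) refl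
      (seq (re z) n) (seq (im z) n) (seq (re w) n) (seq (im w) n))
    (λ n → solve 4 (λ a b c d → a :* d :+ b :* c := c :* b :+ d :* a) refl
      (seq (re z) n) (seq (im z) n) (seq (re w) n) (seq (im w) n))

  *ᶜ-identityˡ : ∀ z → ι 1ℚ *ᶜ z ≈ᶜ z
  *ᶜ-identityˡ z = pointwiseᶜ
    (λ n → solve 2 (λ a b → con 1ℚ :* a :+ :- (con 0ℚ :* b) := a) refl (seq (re z) n) (seq (im z) n))
    (λ n → solve 2 (λ a b → con 1ℚ :* b :+ con 0ℚ :* a := b) refl (seq (re z) n) (seq (im z) n))

  *ᶜ-distribˡ : ∀ z w v → z *ᶜ (w +ᶜ v) ≈ᶜ z *ᶜ w +ᶜ z *ᶜ v
  *ᶜ-distribˡ z w v = pointwiseᶜ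
    (λ n → solve 6 (λ a b c d e f →
        a :* (c :+ e) :+ :- (b :* (d :+ f)) :=
        (a :* c :+ :- (b :* d)) :+ (a :* e :+ :- (b :* f))) refl
      (seq (re z) n) (seq (im z) n) (seq (re w) n) (seq (im w) n) (seq (re v) n) (seq (im v) n))
    (λ n → solve 6 (λ a b c d e f →
        a :* (d :+ f) :+ b :* (c :+ e) :=
        (a :* d :+ b :* c) :+ (a :* f :+ b :* e)) refl
      (seq (re z) n) (seq (im z) n) (seq (re w) n) (seq (im w) n) (seq (re v) n) (seq (im v) n))

ℂ-commutativeRing : CommutativeRing 0ℓ 0ℓ
ℂ-commutativeRing = record
  { Carrier = ℂ ; _≈_ = _≈ᶜ_ ; _+_ = _+ᶜ_ ; _*_ = _*ᶜ_ ; -_ = -ᶜ_ ; 0# = ι 0ℚ ; 1# = ι 1ℚ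
  ; isCommutativeRing = record
    { isRing = record
      { +-isAbelianGroup = record
        { isGroup = record
          { isMonoid = record
            { isSemigroup = record
              { isMagma = record
                { isEquivalence = record { refl = ≈ᶜ-refl ; sym = ≈ᶜ-sym ; trans = ≈ᶜ-trans }
                ; ∙-cong = +ᶜ-cong }
              ; assoc = +ᶜ-assoc }
            ; identity = +ᶜ-identityˡ , λ z → ≈ᶜ-trans (+ᶜ-comm z (ι 0ℚ)) (+ᶜ-identityˡ z) }
          ; inverse = -ᶜ-inverseˡ , λ z → ≈ᶜ-trans (+ᶜ-comm z (-ᶜ z)) (-ᶜ-inverseˡ z)
          ; ⁻¹-cong = -ᶜ-cong }
        ; comm = +ᶜ-comm }
      ; *-cong = *ᶜ-cong
      ; *-assoc = *ᶜ-assoc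
      ; *-identity = *ᶜ-identityˡ , λ z → ≈ᶜ-trans (*ᶜ-comm z (ι 1ℚ)) (*ᶜ-identityˡ z)
      ; distrib = *ᶜ-distribˡ , λ z w v →
          ≈ᶜ-trans (*ᶜ-comm (w +ᶜ v) z)
            (≈ᶜ-trans (*ᶜ-distribˡ z w v) (+ᶜ-cong (*ᶜ-comm z w) (*ᶜ-comm z v))) }
    ; *-comm = *ᶜ-comm } }

module IntervalSum {c ℓ} (R : CommutativeRing c ℓ) where
  open CommutativeRing R using (Carrier; +-monoid)
  open MonoidSum +-monoid using (sum)

  -- ∑ a b f = f a + f (a + 1) + ⋯ + f b, which is 0 when b < a.
  ∑ : ℕ → ℕ → (ℕ → Carrier) → Carrier
  ∑ a b f = sum {suc b ∸ a} λ i → f (a ℕ.+ toℕ i)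

module ℚ-Sum = IntervalSum ℚ.+-*-commutativeRing
module ℂ-Sum = IntervalSum ℂ-commutativeRing

fromℕ : ℕ → ℚ
fromℕ n = + n ℚ./ 1

1/[_!] : ℕ → ℚ
1/[ n !] = (+ 1 ℚ./ (n !)) {{n ℕ.!≢0}}

1/1+_ : ℕ → ℚ
1/1+ n = + 1 ℚ./ suc n

-- All m-tuples of positive integers ≤ n; i : Fin n stands for the integer
-- suc (toℕ i).
tuples : (m n : ℕ) → List (Vec (Fin n) m)
tuples zero    n = Vec.[] ∷ []
tuples (suc m) n = cartesianProductWith Vec._∷_ (allFin n) (tuples m n)

total : ∀ {m n} → Vec (Fin n) m → ℕ
total ks = Vec.sum (Vec.map (λ i → suc (toℕ i)) ks)

reciprocal : ∀ {m n} → Vec (Fin n) m → ℚ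
reciprocal ks = Vec.foldr′ ℚ._*_ 1ℚ (Vec.map (λ i → 1/1+ toℕ i) ks)

-- H n m is H_n(m).  Bounding each k_i by n loses nothing, since
-- k_1 + ⋯ + k_m ≤ n and the k_i are positive.
H : (n m : ℕ) → ℚ
H n zero      = 1ℚ
H n m@(suc _) = foldr ℚ._+_ 0ℚ
  (map reciprocal
    (filter (λ ks → (1 ℕ.≤? total ks) ×-dec (total ks ℕ.≤? n)) (tuples m n)))

harmonic : ℕ → ℚ
harmonic zero    = 0ℚ
harmonic (suc n) = harmonic n ℚ.+ 1/1+ n

-- Formal power series in z; f n is the coefficient of z^n.
Series : Set
Series = ℕ → ℚ

oneˢ : Series
oneˢ zero    = 1ℚ
oneˢ (suc _) = 0ℚ

infixl 7 _*ˢ_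
_*ˢ_ : Series → Series → Series
(f *ˢ g) n = ℚ-Sum.∑ 0 n λ i → f i ℚ.* g (n ∸ i)

infixr 8 _^ˢ_
_^ˢ_ : Series → ℕ → Series
f ^ˢ zero  = oneˢ
f ^ˢ suc k = f *ˢ (f ^ˢ k)

infixr 8 _^ℚ_
_^ℚ_ : ℚ → ℕ → ℚ
_^ℚ_ = RawSemiringDefinitions._^_ (Semiring.rawSemiring (CommutativeRing.semiring ℚ.+-*-commutativeRing))

-- ln(1+z) = z - z²/2 + z³/3 - ⋯
ln[1+z] : Series
ln[1+z] zero    = 0ℚ
ln[1+z] (suc n) = (ℚ.- 1ℚ) ^ℚ n ℚ.* 1/1+ n

-- Signed Stirling numbers of the first kind: n! [z^n] ln(1+z)^k / k!, from
-- their exponential generating function.  For n < k this is 0 because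
-- ln(1+z) has no constant term.
s : (n k : ℕ) → ℚ
s n k = fromℕ (n !) ℚ.* ((ln[1+z] ^ˢ k) n ℚ.* 1/[ k !])

infixr 8 _^ᶜ_
_^ᶜ_ : ℂ → ℕ → ℂ
_^ᶜ_ = RawSemiringDefinitions._^_ (Semiring.rawSemiring (CommutativeRing.semiring ℂ-commutativeRing))

infixl 6 _-ᶜ_
_-ᶜ_ : ℂ → ℂ → ℂ
z -ᶜ w = z +ᶜ -ᶜ w

1ᶜ : ℂ
1ᶜ = ι 1ℚ

falling : ℂ → ℕ → ℂ
falling x zero    = 1ᶜ
falling x (suc k) = falling x k *ᶜ (x -ᶜ ι (fromℕ k))

binom : ℂ → ℕ → ℂ
binom x k = falling x k *ᶜ ι 1/[ k !]

{-# OPTIONS --safe #-}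
module Submission where

-- Substituting z = x/(1-x) turns ln(1+z) into -ln(1-x), and the coefficient of
-- x^(k+1) in f(x/(1-x)) is Σⱼ C(k,j-1) fⱼ.  Hence m! times the inner sum is the
-- coefficient of x^(k+1) in (-ln(1-x))^m, which is H_{k+1}(m) - H_k(m) because
-- (-ln(1-x))^m/(1-x) generates H_n(m).  The identity is then summation by parts,
-- using C(r,k) = C(r-1,k) + C(r-1,k-1).

open import Defs
open import Algebra.Bundles using (CommutativeRing)
open import Algebra.Solver.Ring.AlmostCommutativeRing using (_-Raw-AlmostCommutative⟶_; Induced-equivalence; fromCommutativeRing)
open import Data.Bool.Base using (true; false; if_then_else_)
open import Data.Fin.Base using (Fin; toℕ)
open import Data.Fin.Properties using (toℕ<n)
open import Data.Integer.Base as ℤᵇ using () renaming (+_ to pos)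
open import Data.List.Base using (List; []; _∷_; _++_; map; foldr; filter; tabulate; cartesianProductWith)
open import Data.List.Properties using (map-∘)
open import Data.Nat using (ℕ; suc; _≤_; _∸_)
open import Data.Nat.Base as ℕ using (zero; _<_; z≤n; s≤s; s<s; z<s; _!)
open import Data.Nat.Combinatorics using (_C_; nCk≡nC[n∸k]; nCn≡1; k>n⇒nCk≡0; nCk+nC[k+1]≡[n+1]C[k+1])
open import Data.Product using (_×_; _,_)
open import Data.Rational.Base as ℚ using (ℚ; 0ℚ; 1ℚ; _+_; _*_; -_; fromℚᵘ)
open import Data.Rational.Solver using (module +-*-Solver)
open import Data.Rational.Unnormalised.Base as ℚᵘ using (mkℚᵘ; *≡*)
open import Data.Vec.Base as Vec using (Vec)
open import Function.Base using (_∘_; id)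
open import Level using (0ℓ)
open import Relation.Binary.Definitions using (WeaklyDecidable)
open import Relation.Binary.PropositionalEquality using (_≡_; refl; sym; trans; cong; cong₂; module ≡-Reasoning)
open import Relation.Nullary.Decidable using (Dec; does; yes; no; dec⇒maybe; _×-dec_)
open import Relation.Unary using (Pred; Decidable)
import Algebra.Properties.Semiring.Sum as SemiringSum
import Algebra.Solver.Ring as RingSolver
import Data.Integer.Properties as ℤ
import Data.Maybe.Base as Maybe
import Data.Nat.Properties as ℕ
import Data.Rational.Properties as ℚ
import Data.Rational.Unnormalised.Properties as ℚᵘ
import Relation.Binary.Reasoning.Setoid as SetoidReasoning
open ℂ-Sum using (∑)

open +-*-Solver using (solve; _:=_; _:+_; _:*_; :-_; con)

-- Finite sums

module SumProperties {c ℓ} (R : CommutativeRing c ℓ) where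
  open CommutativeRing R using (Carrier; _≈_; 0#; semiring; +-congˡ; +-congʳ; +-cong; +-identityˡ; +-identityʳ; +-assoc)
    renaming (_+_ to _⊕_; refl to ≈-refl; sym to ≈-sym; trans to ≈-trans)
  open SemiringSum semiring public using (sum; sum-cong-≋; ∑-distrib-+; *-distribˡ-sum)
  open IntervalSum R using () renaming (∑ to ∑′)

  ∑-suc : ∀ n f → ∑′ 0 (suc n) f ≈ ∑′ 0 n f ⊕ f (suc n)
  ∑-suc zero    f = ≈-trans (≈-sym (+-assoc _ _ _)) (≈-trans (+-identityʳ _) (+-congʳ (≈-sym (+-identityʳ _))))
  ∑-suc (suc n) f = ≈-trans (+-congˡ (∑-suc n (f ∘ suc))) (≈-sym (+-assoc _ _ _))

  sum-zero : ∀ {n} {f : Fin n → Carrier} → (∀ i → f i ≈ 0#) → sum f ≈ 0#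
  sum-zero {zero}  p = ≈-refl
  sum-zero {suc n} p = ≈-trans (+-cong (p Fin.zero) (sum-zero (p ∘ Fin.suc))) (+-identityˡ _)

  -- Lets the inner sum of the theorem start at 0 instead of `m`, because s(j,m) = 0 for j < m. When
  -- `m` exceeds `n` the left sum is empty and every term on the right vanishes.
  sum-drop : ∀ m n (f : ℕ → Carrier) → (∀ j → j < m → f j ≈ 0#) →
             sum {n ∸ m} (λ i → f (m ℕ.+ toℕ i)) ≈ sum {n} (f ∘ toℕ)
  sum-drop zero    n       f p = ≈-refl
  sum-drop (suc m) zero    f p = ≈-refl
  sum-drop (suc m) (suc n) f p = ≈-trans (sum-drop m n (f ∘ suc) (λ j j<m → p (suc j) (s<s j<m)))
    (≈-trans (≈-sym (+-identityˡ _)) (+-congʳ (≈-sym (p 0 z<s))))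

open SumProperties ℚ.+-*-commutativeRing

-- Factorials and their reciprocals

-- The comparison takes place in ℚᵘ, where fractions multiply without reduction by a gcd; `toℚᵘ`
-- reflects its equivalence to equality in ℚ.
fromℚᵘ-*-homo : ∀ p q → fromℚᵘ (p ℚᵘ.* q) ≡ fromℚᵘ p * fromℚᵘ q
fromℚᵘ-*-homo p q = ℚ.toℚᵘ-injective (begin
  ℚ.toℚᵘ (fromℚᵘ (p ℚᵘ.* q))                 ≈⟨ ℚ.toℚᵘ-fromℚᵘ (p ℚᵘ.* q) ⟩
  p ℚᵘ.* q                                   ≈⟨ ℚᵘ.*-cong (ℚ.toℚᵘ-fromℚᵘ p) (ℚ.toℚᵘ-fromℚᵘ q) ⟨
  ℚ.toℚᵘ (fromℚᵘ p) ℚᵘ.* ℚ.toℚᵘ (fromℚᵘ q)   ≈⟨ ℚ.toℚᵘ-homo-* (fromℚᵘ p) (fromℚᵘ q) ⟨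
  ℚ.toℚᵘ (fromℚᵘ p * fromℚᵘ q)               ∎)
  where open SetoidReasoning ℚᵘ.≃-setoid

fromℚᵘ-+-homo : ∀ p q → fromℚᵘ (p ℚᵘ.+ q) ≡ fromℚᵘ p + fromℚᵘ q
fromℚᵘ-+-homo p q = ℚ.toℚᵘ-injective (begin
  ℚ.toℚᵘ (fromℚᵘ (p ℚᵘ.+ q))                 ≈⟨ ℚ.toℚᵘ-fromℚᵘ (p ℚᵘ.+ q) ⟩
  p ℚᵘ.+ q                                   ≈⟨ ℚᵘ.+-cong (ℚ.toℚᵘ-fromℚᵘ p) (ℚ.toℚᵘ-fromℚᵘ q) ⟨
  ℚ.toℚᵘ (fromℚᵘ p) ℚᵘ.+ ℚ.toℚᵘ (fromℚᵘ q)   ≈⟨ ℚ.toℚᵘ-homo-+ (fromℚᵘ p) (fromℚᵘ q) ⟨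
  ℚ.toℚᵘ (fromℚᵘ p + fromℚᵘ q)               ∎)
  where open SetoidReasoning ℚᵘ.≃-setoid

fromℕ-+ : ∀ m n → fromℕ (m ℕ.+ n) ≡ fromℕ m + fromℕ n
fromℕ-+ m n = trans (cong (ℚ._/ 1) (sym (cong₂ ℤᵇ._+_ (ℤ.*-identityʳ (pos m)) (ℤ.*-identityʳ (pos n)))))
  (fromℚᵘ-+-homo (mkℚᵘ (pos m) 0) (mkℚᵘ (pos n) 0))

fromℕ-* : ∀ m n → fromℕ (m ℕ.* n) ≡ fromℕ m * fromℕ n
fromℕ-* m n = trans (cong (ℚ._/ 1) (ℤ.pos-* m n)) (fromℚᵘ-*-homo (mkℚᵘ (pos m) 0) (mkℚᵘ (pos n) 0))

fromℕ-*-1/ : ∀ n .{{_ : ℕ.NonZero n}} → fromℕ n * (pos 1 ℚ./ n) ≡ 1ℚ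
fromℕ-*-1/ (suc n) = trans (sym (fromℚᵘ-*-homo (mkℚᵘ (pos (suc n)) 0) (mkℚᵘ (pos 1) n)))
  (ℚ.fromℚᵘ-cong {mkℚᵘ (pos (suc n)) 0 ℚᵘ.* mkℚᵘ (pos 1) n} {mkℚᵘ (pos 1) 0}
    (*≡* (cong pos (trans (ℕ.*-identityʳ (suc n ℕ.* 1))
      (trans (ℕ.*-comm (suc n) 1) (sym (ℕ.*-identityˡ (1 ℕ.* suc n))))))))

n!*1/n! : ∀ n → fromℕ (n !) * 1/[ n !] ≡ 1ℚ
n!*1/n! n = fromℕ-*-1/ (n !) {{n ℕ.!≢0}}

1/n!≡1+n*1/[1+n]! : ∀ n → 1/[ n !] ≡ fromℕ (suc n) * 1/[ suc n !]
1/n!≡1+n*1/[1+n]! n = begin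
  v                  ≡⟨ ℚ.*-identityˡ v ⟨
  1ℚ * v             ≡⟨ cong (_* v) (n!*1/n! (suc n)) ⟨
  fromℕ (suc n !) * u * v  ≡⟨ cong (λ t → t * u * v) (fromℕ-* (suc n) (n !)) ⟩
  a * b * u * v      ≡⟨ solve 4 (λ a b u v → a :* b :* u :* v := a :* u :* (b :* v)) refl a b u v ⟩
  a * u * (b * v)    ≡⟨ cong (λ t → a * u * t) (n!*1/n! n) ⟩
  a * u * 1ℚ         ≡⟨ ℚ.*-identityʳ (a * u) ⟩
  a * u              ∎
  where
  open ≡-Reasoning
  a = fromℕ (suc n)
  b = fromℕ (n !)
  u = 1/[ suc n !]
  v = 1/[ n !]

n!*1/[1+n]!≡1/1+n : ∀ n → fromℕ (n !) * 1/[ suc n !] ≡ 1/1+ n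
n!*1/[1+n]!≡1/1+n n = begin
  b * u              ≡⟨ ℚ.*-identityˡ (b * u) ⟨
  1ℚ * (b * u)       ≡⟨ cong (_* (b * u)) (fromℕ-*-1/ (suc n)) ⟨
  a * w * (b * u)    ≡⟨ solve 4 (λ a b u w → a :* w :* (b :* u) := a :* b :* u :* w) refl a b u w ⟩
  a * b * u * w      ≡⟨ cong (λ t → t * u * w) (fromℕ-* (suc n) (n !)) ⟨
  fromℕ (suc n !) * u * w  ≡⟨ cong (_* w) (n!*1/n! (suc n)) ⟩
  1ℚ * w             ≡⟨ ℚ.*-identityˡ w ⟩
  w                  ∎
  where
  open ≡-Reasoning
  a = fromℕ (suc n)
  b = fromℕ (n !)
  u = 1/[ suc n !]
  w = 1/1+ n

-- The substitution z = x/(1-x)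

tail : Series → Series
tail f n = f (suc n)

*ˢ-cong : ∀ {f f′ g g′ : Series} n → (∀ i → f i ≡ f′ i) → (∀ i → i ≤ n → g i ≡ g′ i) →
          (f *ˢ g) n ≡ (f′ *ˢ g′) n
*ˢ-cong n p q = sum-cong-≋ {suc n} λ i →
  cong₂ _*_ (p (toℕ i)) (q (n ∸ toℕ i) (ℕ.m∸n≤m n (toℕ i)))

-- The closed form is Σⱼ C(k,j) f j. The recursion is Pascal's rule, so inductions on `k` run
-- without binomial coefficients.
binomialTransform : Series → Series
binomialTransform f zero    = f 0
binomialTransform f (suc k) = binomialTransform f k + binomialTransform (tail f) k

-- The coefficients of f(x/(1-x)); binomialTransform f is f(x/(1-x))/(1-x).
euler : Series → Series
euler f zero    = f 0
euler f (suc k) = binomialTransform (tail f) k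

binomialTransform-cong : ∀ k {f g : Series} → (∀ n → f n ≡ g n) →
                         binomialTransform f k ≡ binomialTransform g k
binomialTransform-cong zero    p = p 0
binomialTransform-cong (suc k) p =
  cong₂ _+_ (binomialTransform-cong k p) (binomialTransform-cong k (p ∘ suc))

binomialTransform-+ : ∀ k f g → binomialTransform (λ n → f n + g n) k ≡
                      binomialTransform f k + binomialTransform g k
binomialTransform-+ zero    f g = refl
binomialTransform-+ (suc k) f g =
  trans (cong₂ _+_ (binomialTransform-+ k f g) (binomialTransform-+ k (tail f) (tail g)))
    (solve 4 (λ a b c d → a :+ b :+ (c :+ d) := a :+ c :+ (b :+ d)) refl
      (binomialTransform f k) (binomialTransform g k)
      (binomialTransform (tail f) k) (binomialTransform (tail g) k))

binomialTransform-*ˡ : ∀ k c f → binomialTransform (λ n → c * f n) k ≡ c * binomialTransform f k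
binomialTransform-*ˡ zero    c f = refl
binomialTransform-*ˡ (suc k) c f =
  trans (cong₂ _+_ (binomialTransform-*ˡ k c f) (binomialTransform-*ˡ k c (tail f)))
    (sym (ℚ.*-distribˡ-+ c (binomialTransform f k) (binomialTransform (tail f) k)))

binomialTransform-0 : ∀ k → binomialTransform (λ _ → 0ℚ) k ≡ 0ℚ
binomialTransform-0 zero    = refl
binomialTransform-0 (suc k) = cong₂ _+_ (binomialTransform-0 k) (binomialTransform-0 k)

-- The product (fg)(x/(1-x))/(1-x) carries a single factor 1/(1-x), which is given to f; hence one
-- `binomialTransform` and one `euler`. The recursion calls for the transform of the tail of a
-- product, so the two lemmas are proved together.
binomialTransform-*ˢ : ∀ k f g → binomialTransform (f *ˢ g) k ≡ (binomialTransform f *ˢ euler g) k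
binomialTransform-tail-*ˢ : ∀ k f g → binomialTransform (tail (f *ˢ g)) k ≡
                            f 0 * euler g (suc k) + (binomialTransform (tail f) *ˢ euler g) k

binomialTransform-*ˢ zero    f g = refl
binomialTransform-*ˢ (suc k) f g = begin
  binomialTransform (f *ˢ g) k + binomialTransform (tail (f *ˢ g)) k
    ≡⟨ cong₂ _+_ (binomialTransform-*ˢ k f g) (binomialTransform-tail-*ˢ k f g) ⟩
  P + (f 0 * euler g (suc k) + Q)
    ≡⟨ solve 3 (λ p q t → p :+ (t :+ q) := t :+ (p :+ q)) refl P Q (f 0 * euler g (suc k)) ⟩
  f 0 * euler g (suc k) + (P + Q)
    -- The term `f 0 * euler g (suc k)` is already the head of the convolution at `suc k`; the two
    -- sums at `k` merge into the rest by the recursion for `binomialTransform f`.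
    ≡⟨ cong (λ t → f 0 * euler g (suc k) + t) (begin
         P + Q
           ≡⟨ ∑-distrib-+ {suc k} (λ i → F (toℕ i) * G (toℕ i)) (λ i → F′ (toℕ i) * G (toℕ i)) ⟨
         sum {suc k} (λ i → F (toℕ i) * G (toℕ i) + F′ (toℕ i) * G (toℕ i))
           ≡⟨ sum-cong-≋ {suc k} (λ i → sym (ℚ.*-distribʳ-+ (G (toℕ i)) (F (toℕ i)) (F′ (toℕ i)))) ⟩
         sum {suc k} (λ i → binomialTransform f (suc (toℕ i)) * G (toℕ i)) ∎) ⟩
  (binomialTransform f *ˢ euler g) (suc k) ∎
  where
  open ≡-Reasoning
  F F′ G : Series
  F    = binomialTransform f
  F′   = binomialTransform (tail f)
  G i  = euler g (k ∸ i)
  P Q : ℚ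
  P = (F *ˢ euler g) k
  Q = (F′ *ˢ euler g) k

binomialTransform-tail-*ˢ k f g =
  -- By computation, the tail of `f *ˢ g` is f(0) times the tail of g, plus `tail f *ˢ g`.
  trans (binomialTransform-+ k (λ n → f 0 * g (suc n)) (tail f *ˢ g))
    (cong₂ _+_ (binomialTransform-*ˡ k (f 0) (tail g)) (binomialTransform-*ˢ k (tail f) g))

-- Substitution respects products. In positive degree both sides unfold to the tail lemma.
euler-*ˢ : ∀ n f g → euler (f *ˢ g) n ≡ (euler f *ˢ euler g) n
euler-*ˢ zero    f g = refl
euler-*ˢ (suc k) f g = binomialTransform-tail-*ˢ k f g

nC0≡1 : ∀ n → n C 0 ≡ 1
nC0≡1 n = trans (nCk≡nC[n∸k] {0} {n} z≤n) (nCn≡1 n)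

-- Any bound `n` above `k` is allowed, since C(k,j) = 0 for j > k. The induction uses this slack: f
-- is summed to length `suc n` and its tail to length `n`, so that Pascal's rule pairs the terms.
binomialTransform-sum : ∀ k n f → k < n →
  binomialTransform f k ≡ sum {n} (λ j → fromℕ (k C toℕ j) * f (toℕ j))
binomialTransform-sum zero (suc n) f _ = sym (begin
  fromℕ (0 C 0) * f 0 + sum {n} (λ j → fromℕ (0 C suc (toℕ j)) * f (suc (toℕ j)))
    ≡⟨ cong₂ _+_ (ℚ.*-identityˡ (f 0)) (sum-zero {n} λ j →
         trans (cong (λ t → fromℕ t * f (suc (toℕ j))) (k>n⇒nCk≡0 {0} {suc (toℕ j)} z<s))
           (ℚ.*-zeroˡ (f (suc (toℕ j))))) ⟩
  f 0 + 0ℚ ≡⟨ ℚ.+-identityʳ (f 0) ⟩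
  f 0 ∎)
  where open ≡-Reasoning
binomialTransform-sum (suc k) (suc n) f (s≤s k<n) = begin
  binomialTransform f k + binomialTransform (tail f) k
    ≡⟨ cong₂ _+_ (binomialTransform-sum k (suc n) f (ℕ.m<n⇒m<1+n k<n))
         (binomialTransform-sum k n (tail f) k<n) ⟩
  fromℕ (k C 0) * f 0 + X + Y
    ≡⟨ cong (λ t → fromℕ t * f 0 + X + Y) (trans (nC0≡1 k) (sym (nC0≡1 (suc k)))) ⟩
  fromℕ (suc k C 0) * f 0 + X + Y
    ≡⟨ solve 3 (λ p q t → t :+ p :+ q := t :+ (q :+ p)) refl X Y (fromℕ (suc k C 0) * f 0) ⟩
  fromℕ (suc k C 0) * f 0 + (Y + X)
    ≡⟨ cong (λ t → fromℕ (suc k C 0) * f 0 + t) (trans (sym (∑-distrib-+ {n} y x)) (sum-cong-≋ {n} pascal)) ⟩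
  fromℕ (suc k C 0) * f 0 + sum {n} (λ j → fromℕ (suc k C suc (toℕ j)) * f (suc (toℕ j))) ∎
  where
  open ≡-Reasoning
  x y : Fin n → ℚ
  x j = fromℕ (k C suc (toℕ j)) * f (suc (toℕ j))
  y j = fromℕ (k C toℕ j) * f (suc (toℕ j))
  X Y : ℚ
  X = sum x
  Y = sum y
  pascal : ∀ j → y j + x j ≡ fromℕ (suc k C suc (toℕ j)) * f (suc (toℕ j))
  pascal j = trans (sym (ℚ.*-distribʳ-+ (f (suc (toℕ j))) (fromℕ (k C toℕ j)) (fromℕ (k C suc (toℕ j)))))
    (cong (_* f (suc (toℕ j))) (trans (sym (fromℕ-+ (k C toℕ j) (k C suc (toℕ j))))
      (cong fromℕ (nCk+nC[k+1]≡[n+1]C[k+1] k (toℕ j)))))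

-- Powers of the logarithm

-ln[1-z] : Series
-ln[1-z] zero    = 0ℚ
-ln[1-z] (suc n) = 1/1+ n

-- The value of the Euler integral B(i+1, k+1) = ∫₀¹ tⁱ(1-t)ᵏ dt.
beta : ℕ → ℕ → ℚ
beta i k = fromℕ (i !) * fromℕ (k !) * 1/[ suc (i ℕ.+ k) !]

-- Under the integral this is tⁱ(1-t)ᵏ - tⁱ⁺¹(1-t)ᵏ = tⁱ(1-t)ᵏ⁺¹. Over the common denominator
-- (i+k+2)! it reduces to i+k+2 = (i+1) + (k+1).
beta-suc : ∀ i k → beta i k + - 1ℚ * beta (suc i) k ≡ beta i (suc k)
beta-suc i k = begin
  a * b * 1/[ N !] + - 1ℚ * (fromℕ (suc i !) * b * u)
    ≡⟨ cong₂ (λ s t → a * b * s + - 1ℚ * (t * b * u))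
         (trans (1/n!≡1+n*1/[1+n]! N) (cong (_* u) N+1)) (fromℕ-* (suc i) (i !)) ⟩
  a * b * ((p + q) * u) + - 1ℚ * (p * a * b * u)
    ≡⟨ solve 5 (λ a b p q u → a :* b :* ((p :+ q) :* u) :+ :- con 1ℚ :* (p :* a :* b :* u) :=
                              a :* (q :* b) :* u) refl a b p q u ⟩
  a * (q * b) * u
    ≡⟨ cong₂ (λ t n → a * t * 1/[ suc n !]) (sym (fromℕ-* (suc k) (k !))) (sym (ℕ.+-suc i k)) ⟩
  a * fromℕ (suc k !) * 1/[ suc (i ℕ.+ suc k) !] ∎
  where
  open ≡-Reasoning
  N = suc (i ℕ.+ k)
  a b p q u : ℚ
  a = fromℕ (i !)
  b = fromℕ (k !)
  p = fromℕ (suc i)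
  q = fromℕ (suc k)
  u = 1/[ suc N !]
  N+1 : fromℕ (suc N) ≡ p + q
  N+1 = trans (cong (fromℕ ∘ suc) (sym (ℕ.+-suc i k))) (fromℕ-+ (suc i) (suc k))

-- Integrates tⁱ Σⱼ C(k,j)(-t)ʲ = tⁱ(1-t)ᵏ over [0,1]. The offset `i` is general because passing to
-- the tail raises it by one, at the cost of a sign.
binomialTransform-beta : ∀ k i →
  binomialTransform (λ j → (- 1ℚ) ^ℚ j * 1/1+ (i ℕ.+ j)) k ≡ beta i k
binomialTransform-beta zero i = begin
  1ℚ * 1/1+ (i ℕ.+ 0)                             ≡⟨ ℚ.*-identityˡ (1/1+ (i ℕ.+ 0)) ⟩
  1/1+ (i ℕ.+ 0)                                  ≡⟨ n!*1/[1+n]!≡1/1+n (i ℕ.+ 0) ⟨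
  fromℕ ((i ℕ.+ 0) !) * 1/[ suc (i ℕ.+ 0) !]      ≡⟨ cong (λ t → fromℕ (t !) * 1/[ suc (i ℕ.+ 0) !]) (ℕ.+-identityʳ i) ⟩
  fromℕ (i !) * 1/[ suc (i ℕ.+ 0) !]              ≡⟨ cong (_* 1/[ suc (i ℕ.+ 0) !]) (ℚ.*-identityʳ (fromℕ (i !))) ⟨
  fromℕ (i !) * 1ℚ * 1/[ suc (i ℕ.+ 0) !]         ∎
  where open ≡-Reasoning
binomialTransform-beta (suc k) i = trans
  (cong₂ _+_ (binomialTransform-beta k i)
    (trans (binomialTransform-cong k shifted)
      (trans (binomialTransform-*ˡ k (- 1ℚ) _) (cong (- 1ℚ *_) (binomialTransform-beta k (suc i))))))
  (beta-suc i k)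
  where
  shifted : ∀ j → (- 1ℚ) ^ℚ suc j * 1/1+ (i ℕ.+ suc j) ≡ - 1ℚ * ((- 1ℚ) ^ℚ j * 1/1+ (suc i ℕ.+ j))
  shifted j = trans (ℚ.*-assoc (- 1ℚ) ((- 1ℚ) ^ℚ j) (1/1+ (i ℕ.+ suc j)))
    (cong (λ t → - 1ℚ * ((- 1ℚ) ^ℚ j * 1/1+ t)) (ℕ.+-suc i j))

-- This is ln(1 + x/(1-x)) = -ln(1-x): the case i = 0 of the beta formula gives k!/(k+1)! = 1/(k+1).
euler-ln : ∀ n → euler ln[1+z] n ≡ -ln[1-z] n
euler-ln zero    = refl
euler-ln (suc k) = trans (binomialTransform-beta k 0)
  (trans (cong (_* 1/[ suc k !]) (ℚ.*-identityˡ (fromℕ (k !)))) (n!*1/[1+n]!≡1/1+n k))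

euler-ln^ : ∀ m n → euler (ln[1+z] ^ˢ m) n ≡ (-ln[1-z] ^ˢ m) n
euler-ln^ zero    zero    = refl
euler-ln^ zero    (suc n) = binomialTransform-0 n
euler-ln^ (suc m) n       = trans (euler-*ˢ n ln[1+z] (ln[1+z] ^ˢ m))
  (*ˢ-cong n euler-ln (λ i _ → euler-ln^ m i))

-- The series ln(1+z) is divisible by z, so its `m`-th power is divisible by zᵐ.
ln^-vanishes : ∀ m j → j < m → (ln[1+z] ^ˢ m) j ≡ 0ℚ
ln^-vanishes (suc m) j (s≤s j≤m) = sum-zero {suc j} {λ i → ln[1+z] (toℕ i) * (ln[1+z] ^ˢ m) (j ∸ toℕ i)} λ
  { Fin.zero    → ℚ.*-zeroˡ ((ln[1+z] ^ˢ m) j)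
  ; (Fin.suc i) → trans
      (cong (ln[1+z] (suc (toℕ i)) *_) (ln^-vanishes m (j ∸ suc (toℕ i)) (lower j j≤m (toℕ i) (toℕ<n i))))
      (ℚ.*-zeroʳ (ln[1+z] (suc (toℕ i)))) }
  where
  lower : ∀ j → j ≤ m → ∀ i → i < j → j ∸ suc i < m
  -- The bound i < j excludes j = 0, where truncated subtraction would stay at 0 instead of dropping
  -- below `j`.
  lower (suc j) j<m i _ = ℕ.≤-trans (s≤s (ℕ.m∸n≤m j i)) j<m

stirling-sum : ∀ m k → 1 ≤ m →
  ℚ-Sum.∑ m (suc k) (λ j → fromℕ (k C (j ∸ 1)) * (s j m * 1/[ j !])) ≡
  1/[ m !] * (-ln[1-z] ^ˢ m) (suc k)
stirling-sum m k 1≤m = begin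
  ℚ-Sum.∑ m (suc k) (λ j → fromℕ (k C (j ∸ 1)) * (s j m * 1/[ j !]))
    -- The terms with j < m vanish together with the coefficients of ln(1+z)ᵐ, so the sum may start
    -- at 0.
    ≡⟨ sum-drop m (suc (suc k)) _ (λ j j<m → trans
         (cong (λ t → fromℕ (k C (j ∸ 1)) * t) (trans (stirling j) (trans (cong (v *_) (ln^-vanishes m j j<m)) (ℚ.*-zeroʳ v))))
         (ℚ.*-zeroʳ (fromℕ (k C (j ∸ 1))))) ⟩
  fromℕ (k C 0) * (s 0 m * 1/[ 0 !]) + sum {suc k} (λ j → fromℕ (k C toℕ j) * (s (suc (toℕ j)) m * 1/[ suc (toℕ j) !]))
    -- At j = 0 the truncated `j ∸ 1` is 0, so the binomial coefficient is 1; the term vanishes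
    -- through s(0,m) = 0, which uses 1 ≤ m. The other terms are reindexed by j - 1.
    ≡⟨ cong₂ _+_ (trans (cong (fromℕ (k C 0) *_) (trans (stirling 0) (trans (cong (v *_) (ln^-vanishes m 0 1≤m)) (ℚ.*-zeroʳ v))))
                   (ℚ.*-zeroʳ (fromℕ (k C 0))))
         (sum-cong-≋ {suc k} λ j → cong (fromℕ (k C toℕ j) *_) (stirling (suc (toℕ j)))) ⟩
  0ℚ + sum {suc k} (λ j → fromℕ (k C toℕ j) * (v * a (suc (toℕ j))))
    ≡⟨ ℚ.+-identityˡ _ ⟩
  sum {suc k} (λ j → fromℕ (k C toℕ j) * (v * a (suc (toℕ j))))
    ≡⟨ binomialTransform-sum k (suc k) (λ j → v * a (suc j)) ℕ.≤-refl ⟨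
  binomialTransform (λ j → v * a (suc j)) k
    ≡⟨ binomialTransform-*ˡ k v (tail a) ⟩
  v * euler a (suc k)
    ≡⟨ cong (v *_) (euler-ln^ m (suc k)) ⟩
  v * (-ln[1-z] ^ˢ m) (suc k) ∎
  where
  open ≡-Reasoning
  v : ℚ
  v = 1/[ m !]
  a : Series
  a = ln[1+z] ^ˢ m
  stirling : ∀ j → s j m * 1/[ j !] ≡ v * a j
  stirling j = trans
    (solve 4 (λ p x v u → p :* (x :* v) :* u := p :* u :* (v :* x)) refl (fromℕ (j !)) (a j) v 1/[ j !])
    (trans (cong (_* (v * a j)) (n!*1/n! j)) (ℚ.*-identityˡ (v * a j)))

-- Multiple harmonic-like numbers

-- f ≫ t is x^t f.
infixl 7 _≫_
_≫_ : Series → ℕ → Series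
(f ≫ zero)  n       = f n
(f ≫ suc t) zero    = 0ℚ
(f ≫ suc t) (suc n) = (f ≫ t) n

x^_ : ℕ → Series
x^ t = oneˢ ≫ t

-- The series xⁱf has no coefficient below degree i, so every bound `b` above `n` gives the full
-- convolution.
≫-convolution : ∀ n b (c f : Series) → n < b → sum {b} (λ i → c (toℕ i) * (f ≫ toℕ i) n) ≡ (c *ˢ f) n
≫-convolution zero (suc b) c f _ =
  cong (λ t → c 0 * f 0 + t) (sum-zero {b} {λ i → c (suc (toℕ i)) * 0ℚ} λ i → ℚ.*-zeroʳ (c (suc (toℕ i))))
≫-convolution (suc n) (suc b) c f (s≤s n<b) =
  cong (λ t → c 0 * f (suc n) + t) (≫-convolution n b (tail c) f n<b)

-- Weighted sums over lists

listSum : ∀ {A : Set} → (A → ℚ) → List A → ℚ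
listSum f xs = foldr _+_ 0ℚ (map f xs)

module _ {A : Set} where

  listSum-cong : ∀ {f g : A → ℚ} → (∀ x → f x ≡ g x) → ∀ xs → listSum f xs ≡ listSum g xs
  listSum-cong p []       = refl
  listSum-cong p (x ∷ xs) = cong₂ _+_ (p x) (listSum-cong p xs)

  listSum-0 : ∀ (xs : List A) → listSum (λ _ → 0ℚ) xs ≡ 0ℚ
  listSum-0 []       = refl
  listSum-0 (x ∷ xs) = cong (0ℚ +_) (listSum-0 xs)

  listSum-*ˡ : ∀ c (f : A → ℚ) xs → listSum (λ x → c * f x) xs ≡ c * listSum f xs
  listSum-*ˡ c f []       = sym (ℚ.*-zeroʳ c)
  listSum-*ˡ c f (x ∷ xs) = trans (cong (λ t → c * f x + t) (listSum-*ˡ c f xs)) (sym (ℚ.*-distribˡ-+ c (f x) (listSum f xs)))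

  listSum-++ : ∀ (f : A → ℚ) xs ys → listSum f (xs ++ ys) ≡ listSum f xs + listSum f ys
  listSum-++ f []       ys = sym (ℚ.+-identityˡ (listSum f ys))
  listSum-++ f (x ∷ xs) ys = trans (cong (f x +_) (listSum-++ f xs ys)) (sym (ℚ.+-assoc (f x) (listSum f xs) (listSum f ys)))

  listSum-map : ∀ {B : Set} (f : A → ℚ) (g : B → A) xs → listSum f (map g xs) ≡ listSum (f ∘ g) xs
  listSum-map f g xs = cong (foldr _+_ 0ℚ) (sym (map-∘ xs))

  listSum-filter : ∀ {P : Pred A 0ℓ} (P? : Decidable P) (f : A → ℚ) xs →
                   listSum f (filter P? xs) ≡ listSum (λ x → if does (P? x) then f x else 0ℚ) xs
  listSum-filter P? f []       = refl
  listSum-filter P? f (x ∷ xs) with does (P? x)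
  ... | true  = cong (f x +_) (listSum-filter P? f xs)
  ... | false = trans (listSum-filter P? f xs) (sym (ℚ.+-identityˡ _))

  listSum-sum : ∀ {n} (f : A → Fin n → ℚ) xs →
                listSum (λ x → sum (f x)) xs ≡ sum (λ i → listSum (λ x → f x i) xs)
  listSum-sum {n} f []       = sym (sum-zero {n} {λ _ → 0ℚ} λ _ → refl)
  listSum-sum {n} f (x ∷ xs) = trans (cong (sum (f x) +_) (listSum-sum f xs))
    (sym (∑-distrib-+ {n} (f x) (λ i → listSum (λ x → f x i) xs)))

listSum-cartesianProductWith : ∀ {A B D : Set} {n} (f : D → ℚ) (g : A → B → D) (h : Fin n → A) ys →
  listSum f (cartesianProductWith g (tabulate h) ys) ≡ sum {n} (λ i → listSum (λ y → f (g (h i) y)) ys)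
listSum-cartesianProductWith {n = zero}  f g h ys = refl
listSum-cartesianProductWith {n = suc n} f g h ys =
  trans (listSum-++ f (map (g (h Fin.zero)) ys) _)
    (cong₂ _+_ (listSum-map f (g (h Fin.zero)) ys) (listSum-cartesianProductWith f g (h ∘ Fin.suc) ys))

listSum-≫ : ∀ {A : Set} (w : A → ℚ) (d : A → ℕ) xs t n →
  listSum (λ x → w x * (x^ (t ℕ.+ d x)) n) xs ≡ ((λ n → listSum (λ x → w x * (x^ d x) n) xs) ≫ t) n
listSum-≫ w d xs zero    n       = refl
listSum-≫ w d xs (suc t) zero    = trans (listSum-cong (λ x → ℚ.*-zeroʳ (w x)) xs) (listSum-0 xs)
listSum-≫ w d xs (suc t) (suc n) = listSum-≫ w d xs t n

-- The sum of 1/(k₁⋯kₘ) over k₁ + ⋯ + kₘ = n with all kᵢ ≤ b.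
exactTotal : ℕ → ℕ → Series
exactTotal m b n = listSum (λ ks → reciprocal ks * (x^ total ks) n) (tuples m b)

-- The first entry k₁ contributes the factor x^k₁/k₁, and summing over k₁ ≤ b gives -ln(1-x) cut off
-- after degree `b`. The cutoff is invisible in degree n ≤ b.
exactTotal-suc : ∀ m b n → n ≤ b → exactTotal (suc m) b n ≡ (-ln[1-z] *ˢ exactTotal m b) n
exactTotal-suc m b n n≤b = begin
  exactTotal (suc m) b n
    ≡⟨ listSum-cartesianProductWith {n = b} (λ ks → reciprocal ks * (x^ total ks) n) Vec._∷_ id (tuples m b) ⟩
  sum {b} (λ i → listSum (λ ks → 1/1+ toℕ i * reciprocal ks * (x^ (suc (toℕ i) ℕ.+ total ks)) n) (tuples m b))
    ≡⟨ sum-cong-≋ {b} (λ i → trans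
         (listSum-cong (λ ks → ℚ.*-assoc (1/1+ toℕ i) (reciprocal ks) ((x^ (suc (toℕ i) ℕ.+ total ks)) n)) (tuples m b))
         (trans (listSum-*ˡ (1/1+ toℕ i) (λ ks → reciprocal ks * (x^ (suc (toℕ i) ℕ.+ total ks)) n) (tuples m b))
           (cong (1/1+ toℕ i *_) (listSum-≫ reciprocal total (tuples m b) (suc (toℕ i)) n)))) ⟩
  sum {b} (λ i → 1/1+ toℕ i * (exactTotal m b ≫ suc (toℕ i)) n)
    -- A zero term is prepended for index 0, matching the zero constant coefficient of `-ln[1-z]`.
    ≡⟨ ℚ.+-identityˡ _ ⟨
  0ℚ + sum {b} (λ i → 1/1+ toℕ i * (exactTotal m b ≫ suc (toℕ i)) n)
    ≡⟨ cong (_+ sum {b} (λ i → 1/1+ toℕ i * (exactTotal m b ≫ suc (toℕ i)) n)) (ℚ.*-zeroˡ (exactTotal m b n)) ⟨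
  sum {suc b} (λ i → -ln[1-z] (toℕ i) * (exactTotal m b ≫ toℕ i) n)
    ≡⟨ ≫-convolution n (suc b) -ln[1-z] (exactTotal m b) (s≤s n≤b) ⟩
  (-ln[1-z] *ˢ exactTotal m b) n ∎
  where open ≡-Reasoning

exactTotal-ln^ : ∀ m b n → n ≤ b → exactTotal m b n ≡ (-ln[1-z] ^ˢ m) n
exactTotal-ln^ zero    b n n≤b = trans (ℚ.+-identityʳ (1ℚ * oneˢ n)) (ℚ.*-identityˡ (oneˢ n))
exactTotal-ln^ (suc m) b n n≤b = trans (exactTotal-suc m b n n≤b)
  (*ˢ-cong {f = -ln[1-z]} n (λ _ → refl) (λ i i≤n → exactTotal-ln^ m b i (ℕ.≤-trans i≤n n≤b)))

-- With `∑-x^->`, this shows that the partial sums of the coefficients of xᵗ are the indicator of t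
-- ≤ n, which then replaces the filter in `H`.
∑-x^-≤ : ∀ t n → t ≤ n → ℚ-Sum.∑ 0 n (x^ t) ≡ 1ℚ
∑-x^-≤ zero    n       t≤n       = cong (1ℚ +_) (sum-zero {n} {λ _ → 0ℚ} λ _ → refl)
∑-x^-≤ (suc t) (suc n) (s≤s t≤n) = cong (0ℚ +_) (∑-x^-≤ t n t≤n)

∑-x^-> : ∀ t n → n < t → ℚ-Sum.∑ 0 n (x^ t) ≡ 0ℚ
∑-x^-> (suc t) zero    n<t       = refl
∑-x^-> (suc t) (suc n) (s≤s n<t) = cong (0ℚ +_) (∑-x^-> t n n<t)

-- Writing the condition on the total as a sum over exact totals j ≤ n and interchanging the two
-- sums leaves the coefficients of (-ln(1-x))ᵐ.
H-partial-sum : ∀ m n → 1 ≤ m → H n m ≡ ℚ-Sum.∑ 0 n (-ln[1-z] ^ˢ m)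
H-partial-sum (suc m) n _ = begin
  H n (suc m)
    ≡⟨ listSum-filter P? reciprocal (tuples (suc m) n) ⟩
  listSum (λ ks → if does (P? ks) then reciprocal ks else 0ℚ) (tuples (suc m) n)
    ≡⟨ listSum-cong indicator (tuples (suc m) n) ⟩
  listSum (λ ks → sum {suc n} (λ j → reciprocal ks * (x^ total ks) (toℕ j))) (tuples (suc m) n)
    ≡⟨ listSum-sum {n = suc n} (λ ks j → reciprocal ks * (x^ total ks) (toℕ j)) (tuples (suc m) n) ⟩
  ℚ-Sum.∑ 0 n (exactTotal (suc m) n)
    ≡⟨ sum-cong-≋ {suc n} (λ j → exactTotal-ln^ (suc m) n (toℕ j) (ℕ.s≤s⁻¹ (toℕ<n j))) ⟩
  ℚ-Sum.∑ 0 n (-ln[1-z] ^ˢ suc m) ∎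
  where
  open ≡-Reasoning
  P? = λ (ks : Vec (Fin n) (suc m)) → (1 ℕ.≤? total ks) ×-dec (total ks ℕ.≤? n)
  indicator : ∀ ks → (if does (P? ks) then reciprocal ks else 0ℚ) ≡
              sum {suc n} (λ j → reciprocal ks * (x^ total ks) (toℕ j))
  -- For a visibly nonempty tuple the total is a successor, so the test 1 ≤ total evaluates to true
  -- and the comparison with `n` decides.
  indicator ks@(_ Vec.∷ _) = trans (select (total ks ℕ.≤? n))
    (*-distribˡ-sum {suc n} (reciprocal ks) (λ j → (x^ total ks) (toℕ j)))
    where
    select : (d : Dec (total ks ≤ n)) →
             (if does d then reciprocal ks else 0ℚ) ≡ reciprocal ks * ℚ-Sum.∑ 0 n (x^ total ks)
    select (yes t≤n) = trans (sym (ℚ.*-identityʳ (reciprocal ks)))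
                         (cong (reciprocal ks *_) (sym (∑-x^-≤ (total ks) n t≤n)))
    select (no t≰n)  = trans (sym (ℚ.*-zeroʳ (reciprocal ks)))
                         (cong (reciprocal ks *_) (sym (∑-x^-> (total ks) n (ℕ.≰⇒> t≰n))))

H-suc : ∀ m k → 1 ≤ m → H (suc k) m ≡ H k m + (-ln[1-z] ^ˢ m) (suc k)
H-suc m k 1≤m = begin
  H (suc k) m                                       ≡⟨ H-partial-sum m (suc k) 1≤m ⟩
  ℚ-Sum.∑ 0 (suc k) (-ln[1-z] ^ˢ m)                 ≡⟨ ∑-suc k (-ln[1-z] ^ˢ m) ⟩
  ℚ-Sum.∑ 0 k (-ln[1-z] ^ˢ m) + (-ln[1-z] ^ˢ m) (suc k)
    ≡⟨ cong (_+ (-ln[1-z] ^ˢ m) (suc k)) (H-partial-sum m k 1≤m) ⟨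
  H k m + (-ln[1-z] ^ˢ m) (suc k) ∎
  where open ≡-Reasoning

-- Complex binomial coefficients

open CommutativeRing ℂ-commutativeRing using (setoid; +-cong; +-congˡ; *-cong; *-congˡ; *-congʳ; -‿cong)
  renaming (refl to ≈-refl; sym to ≈-sym; trans to ≈-trans; reflexive to ≈-reflexive)
module ℂ-SumProperties = SumProperties ℂ-commutativeRing

ι-+ : ∀ p q → ι (p + q) ≈ᶜ ι p +ᶜ ι q
ι-+ p q = pointwiseᶜ (λ _ → refl) (λ _ → refl)

ι-* : ∀ p q → ι (p * q) ≈ᶜ ι p *ᶜ ι q
ι-* p q = pointwiseᶜ
  (λ _ → solve 2 (λ p q → p :* q := p :* q :+ :- (con 0ℚ :* con 0ℚ)) refl p q)
  (λ _ → solve 2 (λ p q → con 0ℚ := p :* con 0ℚ :+ con 0ℚ :* q) refl p q)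

ι-neg : ∀ p → ι (- p) ≈ᶜ -ᶜ ι p
ι-neg p = pointwiseᶜ (λ _ → refl) (λ _ → refl)

ι-morphism : CommutativeRing.rawRing ℚ.+-*-commutativeRing -Raw-AlmostCommutative⟶ fromCommutativeRing ℂ-commutativeRing
ι-morphism = record
  { ⟦_⟧ = ι ; +-homo = ι-+ ; *-homo = ι-* ; -‿homo = ι-neg ; 0-homo = ≈-refl ; 1-homo = ≈-refl }

ι-≈? : WeaklyDecidable (Induced-equivalence ι-morphism)
ι-≈? p q = Maybe.map (λ p≡q → ≈-reflexive (cong ι p≡q)) (dec⇒maybe (p ℚ.≟ q))

-- A ring solver for ℂ whose coefficients are the decidable ℚ, embedded by ι.
module ℂ-Solver = RingSolver (CommutativeRing.rawRing ℚ.+-*-commutativeRing) (fromCommutativeRing ℂ-commutativeRing) ι-morphism ι-≈?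

open ℂ-Solver using ()
  renaming (solve to solveᶜ; _:=_ to _⊜_; _:+_ to _⊕_; _:*_ to _⊗_; :-_ to ⊝_; con to conᶜ)

ι-sum : ∀ {n} (f : Fin n → ℚ) → ι (sum f) ≈ᶜ ℂ-SumProperties.sum (ι ∘ f)
ι-sum {zero}  f = ≈-refl
ι-sum {suc n} f = ≈-trans (ι-+ (f Fin.zero) (sum (f ∘ Fin.suc))) (+-congˡ (ι-sum (f ∘ Fin.suc)))

ι-1+n : ∀ n → ι (fromℕ (suc n)) ≈ᶜ 1ᶜ +ᶜ ι (fromℕ n)
ι-1+n n = ≈-trans (≈-reflexive (cong ι (fromℕ-+ 1 n))) (ι-+ 1ℚ (fromℕ n))

-- `falling` splits off its last factor; splitting off the first one exposes `falling (r -ᶜ 1ᶜ) k`,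
-- the common factor in Pascal's rule.
falling-suc : ∀ r k → falling r (suc k) ≈ᶜ r *ᶜ falling (r -ᶜ 1ᶜ) k
falling-suc r zero    = solveᶜ 1 (λ r → conᶜ 1ℚ ⊗ (r ⊕ ⊝ conᶜ 0ℚ) ⊜ r ⊗ conᶜ 1ℚ) ≈-refl r
falling-suc r (suc k) = begin
  falling r (suc k) *ᶜ (r -ᶜ ι (fromℕ (suc k)))
    ≈⟨ *-cong (falling-suc r k) (+-congˡ (-‿cong (ι-1+n k))) ⟩
  r *ᶜ A *ᶜ (r -ᶜ (1ᶜ +ᶜ x))
    ≈⟨ solveᶜ 3 (λ r a x → r ⊗ a ⊗ (r ⊕ ⊝ (conᶜ 1ℚ ⊕ x)) ⊜ r ⊗ (a ⊗ (r ⊕ ⊝ conᶜ 1ℚ ⊕ ⊝ x))) ≈-refl r A x ⟩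
  r *ᶜ (A *ᶜ (r -ᶜ 1ᶜ -ᶜ x)) ∎
  where
  open SetoidReasoning setoid
  A x : ℂ
  A = falling (r -ᶜ 1ᶜ) k
  x = ι (fromℕ k)

binom-pascal : ∀ r k → binom r (suc k) ≈ᶜ binom (r -ᶜ 1ᶜ) (suc k) +ᶜ binom (r -ᶜ 1ᶜ) k
binom-pascal r k = begin
  falling r (suc k) *ᶜ u
    ≈⟨ *-congʳ (falling-suc r k) ⟩
  r *ᶜ A *ᶜ u
    -- Splits r as (r - 1 - k) + (k + 1); the factor k + 1 then turns 1/(k+1)! into 1/k!.
    ≈⟨ solveᶜ 4 (λ r a x u → r ⊗ a ⊗ u ⊜
         a ⊗ (r ⊕ ⊝ conᶜ 1ℚ ⊕ ⊝ x) ⊗ u ⊕ a ⊗ ((conᶜ 1ℚ ⊕ x) ⊗ u)) ≈-refl r A x u ⟩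
  A *ᶜ (r -ᶜ 1ᶜ -ᶜ x) *ᶜ u +ᶜ A *ᶜ ((1ᶜ +ᶜ x) *ᶜ u)
    ≈⟨ +-congˡ (*-congˡ (begin
         (1ᶜ +ᶜ x) *ᶜ u                        ≈⟨ *-congʳ (ι-1+n k) ⟨
         ι (fromℕ (suc k)) *ᶜ u                ≈⟨ ι-* (fromℕ (suc k)) 1/[ suc k !] ⟨
         ι (fromℕ (suc k) * 1/[ suc k !])      ≈⟨ ≈-reflexive (cong ι (1/n!≡1+n*1/[1+n]! k)) ⟨
         ι 1/[ k !] ∎)) ⟩
  binom (r -ᶜ 1ᶜ) (suc k) +ᶜ binom (r -ᶜ 1ᶜ) k ∎
  where
  open SetoidReasoning setoid
  A x u : ℂ
  A = falling (r -ᶜ 1ᶜ) k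
  x = ι (fromℕ k)
  u = ι 1/[ suc k !]

-- Signed binomial coefficients and summation by parts

signedBinom : ℂ → ℕ → ℂ
signedBinom r k = (-ᶜ 1ᶜ) ^ᶜ k *ᶜ binom r k

-- The coefficient form of (1-x)ʳ = (1-x)(1-x)ʳ⁻¹: the alternating sign turns Pascal's sum into a
-- difference, as summation by parts requires.
signedBinom-pascal : ∀ r k →
  signedBinom r (suc k) ≈ᶜ signedBinom (r -ᶜ 1ᶜ) (suc k) -ᶜ signedBinom (r -ᶜ 1ᶜ) k
signedBinom-pascal r k = ≈-trans (*-congˡ (binom-pascal r k))
  (solveᶜ 3 (λ e a b → ⊝ conᶜ 1ℚ ⊗ e ⊗ (a ⊕ b) ⊜ ⊝ conᶜ 1ℚ ⊗ e ⊗ a ⊕ ⊝ (e ⊗ b)) ≈-refl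
    ((-ᶜ 1ᶜ) ^ᶜ k) (binom (r -ᶜ 1ᶜ) (suc k)) (binom (r -ᶜ 1ᶜ) k))

summation-by-parts : ∀ r (F : ℕ → ℂ) n →
  ∑ 0 n (λ k → signedBinom (r -ᶜ 1ᶜ) k *ᶜ (F (suc k) -ᶜ F k)) ≈ᶜ
  signedBinom (r -ᶜ 1ᶜ) n *ᶜ F (suc n) -ᶜ ∑ 0 n (λ k → signedBinom r k *ᶜ F k)
summation-by-parts r F zero =
  -- At index 0 the signed coefficients for r - 1 and for r unfold to the same constant, passed to
  -- the solver as `c`.
  solveᶜ 3 (λ c x y → c ⊗ (x ⊕ ⊝ y) ⊕ conᶜ 0ℚ ⊜ c ⊗ x ⊕ ⊝ (c ⊗ y ⊕ conᶜ 0ℚ)) ≈-refl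
    (1ᶜ *ᶜ (1ᶜ *ᶜ ι 1/[ 0 !])) (F 1) (F 0)
summation-by-parts r F (suc n) = begin
  ∑ 0 (suc n) f
    ≈⟨ ℂ-SumProperties.∑-suc n f ⟩
  ∑ 0 n f +ᶜ c (suc n) *ᶜ (F (suc (suc n)) -ᶜ F (suc n))
    ≈⟨ +-cong (summation-by-parts r F n) ≈-refl ⟩
  c n *ᶜ F (suc n) -ᶜ ∑ 0 n g +ᶜ c (suc n) *ᶜ (F (suc (suc n)) -ᶜ F (suc n))
    -- Collects the coefficient of F(n+1) as the difference of consecutive signed coefficients for r
    -- - 1, which is the one for r.
    ≈⟨ solveᶜ 5 (λ c c′ x y s → c ⊗ x ⊕ ⊝ s ⊕ c′ ⊗ (y ⊕ ⊝ x) ⊜ c′ ⊗ y ⊕ ⊝ (s ⊕ (c′ ⊕ ⊝ c) ⊗ x)) ≈-refl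
         (c n) (c (suc n)) (F (suc n)) (F (suc (suc n))) (∑ 0 n g) ⟩
  c (suc n) *ᶜ F (suc (suc n)) -ᶜ (∑ 0 n g +ᶜ (c (suc n) -ᶜ c n) *ᶜ F (suc n))
    ≈⟨ +-congˡ (-‿cong (+-congˡ (*-congʳ (signedBinom-pascal r n)))) ⟨
  c (suc n) *ᶜ F (suc (suc n)) -ᶜ (∑ 0 n g +ᶜ g (suc n))
    ≈⟨ +-congˡ (-‿cong (ℂ-SumProperties.∑-suc n g)) ⟨
  c (suc n) *ᶜ F (suc (suc n)) -ᶜ ∑ 0 (suc n) g ∎
  where
  open SetoidReasoning setoid
  c f g : ℕ → ℂ
  c   = signedBinom (r -ᶜ 1ᶜ)
  f k = c k *ᶜ (F (suc k) -ᶜ F k)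
  g k = signedBinom r k *ᶜ F k

-- The inner sum as a difference, and the two identities

inner-sum : ∀ m k → 1 ≤ m →
  ∑ m (suc k) (λ j → ι (fromℕ (k C (j ∸ 1))) *ᶜ (ι (s j m) *ᶜ ι 1/[ j !])) ≈ᶜ
  ι 1/[ m !] *ᶜ ι (H (suc k) m) -ᶜ ι 1/[ m !] *ᶜ ι (H k m)
inner-sum m k 1≤m = begin
  ∑ m (suc k) (λ j → ι (fromℕ (k C (j ∸ 1))) *ᶜ (ι (s j m) *ᶜ ι 1/[ j !]))
    ≈⟨ ℂ-SumProperties.sum-cong-≋ {suc (suc k) ∸ m} (λ i → ι-term (m ℕ.+ toℕ i)) ⟨
  ∑ m (suc k) (λ j → ι (fromℕ (k C (j ∸ 1)) * (s j m * 1/[ j !])))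
    ≈⟨ ι-sum {suc (suc k) ∸ m} (λ i → let j = m ℕ.+ toℕ i in fromℕ (k C (j ∸ 1)) * (s j m * 1/[ j !])) ⟨
  ι (ℚ-Sum.∑ m (suc k) (λ j → fromℕ (k C (j ∸ 1)) * (s j m * 1/[ j !])))
    ≈⟨ ≈-reflexive (cong ι (stirling-sum m k 1≤m)) ⟩
  ι (1/[ m !] * h)
    ≈⟨ ι-* 1/[ m !] h ⟩
  ι 1/[ m !] *ᶜ ι h
    -- Adds and subtracts H_k(m)/m!, so that the inner sum becomes the increment of F(k) =
    -- H_k(m)/m!.
    ≈⟨ solveᶜ 3 (λ v x y → v ⊗ x ⊜ v ⊗ (y ⊕ x) ⊕ ⊝ (v ⊗ y)) ≈-refl (ι 1/[ m !]) (ι h) (ι (H k m)) ⟩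
  ι 1/[ m !] *ᶜ (ι (H k m) +ᶜ ι h) -ᶜ ι 1/[ m !] *ᶜ ι (H k m)
    ≈⟨ +-cong (*-congˡ (≈-trans (≈-reflexive (cong ι (H-suc m k 1≤m))) (ι-+ (H k m) h))) ≈-refl ⟨
  ι 1/[ m !] *ᶜ ι (H (suc k) m) -ᶜ ι 1/[ m !] *ᶜ ι (H k m) ∎
  where
  open SetoidReasoning setoid
  h : ℚ
  h = (-ln[1-z] ^ˢ m) (suc k)
  ι-term : ∀ j → ι (fromℕ (k C (j ∸ 1)) * (s j m * 1/[ j !])) ≈ᶜ
                 ι (fromℕ (k C (j ∸ 1))) *ᶜ (ι (s j m) *ᶜ ι 1/[ j !])
  ι-term j = ≈-trans (ι-* (fromℕ (k C (j ∸ 1))) (s j m * 1/[ j !])) (*-congˡ (ι-* (s j m) 1/[ j !]))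

theorem9 : (r : ℂ) →
    ((m n : ℕ) → 1 ≤ m → 1 ≤ n →
    ∑ 0 n (λ k → (-ᶜ 1ᶜ) ^ᶜ k *ᶜ binom (r -ᶜ 1ᶜ) k *ᶜ
    ∑ m (suc k) (λ j → ι (fromℕ (k C (j ∸ 1))) *ᶜ (ι (s j m) *ᶜ ι 1/[ j !])))
    ≈ᶜ
    (-ᶜ 1ᶜ) ^ᶜ n *ᶜ binom (r -ᶜ 1ᶜ) n *ᶜ ι 1/[ m !] *ᶜ ι (H (suc n) m)
    -ᶜ ι 1/[ m !] *ᶜ ∑ 0 n (λ k → (-ᶜ 1ᶜ) ^ᶜ k *ᶜ binom r k *ᶜ ι (H k m)))
    ×
    ((n : ℕ) → 1 ≤ n →
    ∑ 0 n (λ k → (-ᶜ 1ᶜ) ^ᶜ k *ᶜ ι (1/1+ k) *ᶜ binom (r -ᶜ 1ᶜ) k)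
    ≈ᶜ
    (-ᶜ 1ᶜ) ^ᶜ n *ᶜ binom (r -ᶜ 1ᶜ) n *ᶜ ι (harmonic (suc n))
    -ᶜ ∑ 0 n (λ k → (-ᶜ 1ᶜ) ^ᶜ k *ᶜ binom r k *ᶜ ι (harmonic k)))
theorem9 r = general , special
  where
  open SetoidReasoning setoid
  c : ℕ → ℂ
  c = signedBinom (r -ᶜ 1ᶜ)
  general : (m n : ℕ) → 1 ≤ m → 1 ≤ n →
    ∑ 0 n (λ k → c k *ᶜ ∑ m (suc k) (λ j → ι (fromℕ (k C (j ∸ 1))) *ᶜ (ι (s j m) *ᶜ ι 1/[ j !]))) ≈ᶜ
    c n *ᶜ ι 1/[ m !] *ᶜ ι (H (suc n) m) -ᶜ ι 1/[ m !] *ᶜ ∑ 0 n (λ k → signedBinom r k *ᶜ ι (H k m))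
  general m n 1≤m _ = begin
    ∑ 0 n (λ k → c k *ᶜ ∑ m (suc k) (λ j → ι (fromℕ (k C (j ∸ 1))) *ᶜ (ι (s j m) *ᶜ ι 1/[ j !])))
      ≈⟨ ℂ-SumProperties.sum-cong-≋ {suc n} (λ i → *-congˡ {c (toℕ i)} (inner-sum m (toℕ i) 1≤m)) ⟩
    ∑ 0 n (λ k → c k *ᶜ (F (suc k) -ᶜ F k))
      ≈⟨ summation-by-parts r F n ⟩
    c n *ᶜ F (suc n) -ᶜ ∑ 0 n (λ k → signedBinom r k *ᶜ F k)
      ≈⟨ +-cong (solveᶜ 3 (λ c v h → c ⊗ (v ⊗ h) ⊜ c ⊗ v ⊗ h) ≈-refl (c n) v (ι (H (suc n) m)))
           (-‿cong (≈-trans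
             (ℂ-SumProperties.sum-cong-≋ {suc n} (λ i →
               solveᶜ 3 (λ d v h → d ⊗ (v ⊗ h) ⊜ v ⊗ (d ⊗ h)) ≈-refl (signedBinom r (toℕ i)) v (ι (H (toℕ i) m))))
             (≈-sym (ℂ-SumProperties.*-distribˡ-sum {suc n} v (λ i → signedBinom r (toℕ i) *ᶜ ι (H (toℕ i) m)))))) ⟩
    c n *ᶜ v *ᶜ ι (H (suc n) m) -ᶜ v *ᶜ ∑ 0 n (λ k → signedBinom r k *ᶜ ι (H k m)) ∎
    where
    v : ℂ
    v = ι 1/[ m !]
    F : ℕ → ℂ
    F k = v *ᶜ ι (H k m)
  special : (n : ℕ) → 1 ≤ n →
    ∑ 0 n (λ k → (-ᶜ 1ᶜ) ^ᶜ k *ᶜ ι (1/1+ k) *ᶜ binom (r -ᶜ 1ᶜ) k) ≈ᶜ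
    c n *ᶜ ι (harmonic (suc n)) -ᶜ ∑ 0 n (λ k → signedBinom r k *ᶜ ι (harmonic k))
  -- Here F(k) = H_k, whose increment is 1/(k+1) by the definition of `harmonic`.
  special n _ = ≈-trans (ℂ-SumProperties.sum-cong-≋ {suc n} (λ i → term (toℕ i)))
    (summation-by-parts r (ι ∘ harmonic) n)
    where
    term : ∀ k → (-ᶜ 1ᶜ) ^ᶜ k *ᶜ ι (1/1+ k) *ᶜ binom (r -ᶜ 1ᶜ) k ≈ᶜ
                 c k *ᶜ (ι (harmonic (suc k)) -ᶜ ι (harmonic k))
    term k = begin
      e *ᶜ x *ᶜ b
        ≈⟨ solveᶜ 4 (λ e x b y → e ⊗ x ⊗ b ⊜ e ⊗ b ⊗ (y ⊕ x ⊕ ⊝ y)) ≈-refl e x b y ⟩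
      e *ᶜ b *ᶜ (y +ᶜ x -ᶜ y)
        ≈⟨ *-congˡ (+-cong (ι-+ (harmonic k) (1/1+ k)) ≈-refl) ⟨
      c k *ᶜ (ι (harmonic (suc k)) -ᶜ y) ∎
      where
      e x b y : ℂ
      e = (-ᶜ 1ᶜ) ^ᶜ k
      x = ι (1/1+ k)
      b = binom (r -ᶜ 1ᶜ) k
      y = ι (harmonic k)
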